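{- Let $\mathcal{S} \subseteq 2^{\mathcal{T}_Y}$ be an algebraic closure system which is closed under time shifts. Then there is a theory $\Sigma$ such that $\mathcal{S} = \mathrm{Mod}(\Sigma)$.
   Context: $Y$ is a non-empty finite set of attributes and $\mathcal{T}_Y = \{y^i \mid y \in Y, i \in \mathbb{Z}\}$. For $M \subseteq \mathcal{T}_Y$ and $j \in \mathbb{Z}$, $M + j = \{y^{i+j} \mid y^i \in M\}$. A closure system on $\mathcal{T}_Y$ is a family closed under arbitrary intersections; it induces the closure operator $\mathrm{C}_\mathcal{S}(M) = \bigcap\{N \in \mathcal{S} \mid M \subseteq N\}$. It is algebraic if $\mathrm{C}_\mathcal{S}(M) = \bigcup\{\mathrm{C}_\mathcal{S}(B) \mid B \subseteq M, B \text{ finite}\}$ for all $M$. $\mathcal{S}$ is closed under time shifts if $M+i \in \mathcal{S}$ for all $M \in \mathcal{S}$, $i \in \mathbb{Z}$. A formula is $A \Rightarrow B$ with $A,B$ finite subsets of $\mathcal{T}_Y$; $M \models A \Rightarrow B$ means that for every $i \in \mathbb{Z}$, $A+i \subseteq M$ implies $B+i \subseteq M$. A theory is a set of formulas and $\mathrm{Mod}(\Sigma)$ is the set of all $M \subseteq \mathcal{T}_Y$ in which all formulas of $\Sigma$ are true. -}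

module Defs where

open import Level using (Level; suc)
open import Data.Integer.Base using (ℤ; _+_)
open import Data.List.Base using (List)
import Data.List.Membership.Propositional as List
open import Data.Product using (_×_; _,_; ∃-syntax)
open import Relation.Binary.PropositionalEquality using (_≡_)
open import Relation.Unary using (Pred; _∈_; _⊆_; _≐_)

private
  variable
    ℓ : Level
    Y : Set ℓ

-- (y , i) stands for yⁱ.
𝒯 : Set ℓ → Set ℓ
𝒯 Y = Y × ℤ

Subset : Set ℓ → Set (suc ℓ)
Subset {ℓ} Y = Pred (𝒯 Y) ℓ

Family : Set ℓ → Set (suc (suc ℓ))
Family {ℓ} Y = Pred (Subset Y) (suc ℓ)

infixl 6 _⊕_
_⊕_ : Subset Y → ℤ → Subset Y
(M ⊕ j) t = ∃[ y ] ∃[ i ] ((y , i) ∈ M × t ≡ (y , i + j))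

Finite : Subset Y → Set _
Finite {Y = Y} A = ∃[ xs ] A ≐ (List._∈ xs)

-- Quantifying over all members of a family raises the level, so ⋂ F is not
-- itself a `Subset Y`.
⋂ : Family Y → Pred (𝒯 Y) _
⋂ F t = ∀ N → N ∈ F → t ∈ N

-- Because of the level of ⋂ F, closure under intersections speaks of every
-- subset M that is extensionally equal to ⋂ F.  The empty family is allowed,
-- and F = { N } shows that a closure system respects extensional equality.
IsClosureSystem : Family Y → Set _
IsClosureSystem {Y = Y} 𝒮 =
  (F : Family Y) → F ⊆ 𝒮 → (M : Subset Y) → M ≐ ⋂ F → M ∈ 𝒮

C : Family Y → Subset Y → Pred (𝒯 Y) _
C 𝒮 M = ⋂ (λ N → N ∈ 𝒮 × M ⊆ N)

IsAlgebraic : Family Y → Set _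
IsAlgebraic {Y = Y} 𝒮 =
  (M : Subset Y) → C 𝒮 M ≐ (λ t → ∃[ B ] (B ⊆ M × Finite B × t ∈ C 𝒮 B))

ShiftClosed : Family Y → Set _
ShiftClosed {Y = Y} 𝒮 = (M : Subset Y) (i : ℤ) → M ∈ 𝒮 → M ⊕ i ∈ 𝒮

infix 5 _⇒_
record Formula (Y : Set ℓ) : Set (suc ℓ) where
  constructor _⇒_
  field
    antecedent : ∃[ A ] Finite {Y = Y} A
    consequent : ∃[ B ] Finite {Y = Y} B

infix 4 _⊨_
_⊨_ : Subset Y → Formula Y → Set _
M ⊨ (A , _) ⇒ (B , _) = ∀ i → A ⊕ i ⊆ M → B ⊕ i ⊆ M

Theory : Set ℓ → Set (suc (suc ℓ))
Theory {ℓ} Y = Pred (Formula Y) (suc ℓ)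

Mod : Theory Y → Family Y
Mod Σ M = ∀ φ → φ ∈ Σ → M ⊨ φ

{-# OPTIONS --safe #-}

-- Σ consists of all A ⇒ B with B ⊆ C 𝒮 A.  Shifting a member M of 𝒮 back by i
-- turns the instance of A ⇒ B at i into the one at 0, so M is a model.
-- Conversely, by algebraicity each t ∈ C 𝒮 M lies in C 𝒮 B for some finite
-- B ⊆ M, and the formula B ⇒ { t } of Σ puts t into a model M.
module Submission where

open import Data.Nat.Base using (ℕ)
open import Data.Fin.Base using (Fin)
open import Data.Integer.Base using (0ℤ; _+_; -_)
open import Data.Integer.Properties
  using (+-assoc; +-identityʳ; +-inverseˡ; +-inverseʳ)
open import Data.List.Base using ([_])
open import Data.List.Relation.Unary.Any using (here)
open import Data.List.Relation.Unary.Any.Properties using (singleton⁻)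
open import Data.Product using (∃; _×_; _,_; proj₁)
open import Function.Bundles using (_↔_)
open import Level using (Level)
open import Relation.Binary.PropositionalEquality
  using (_≡_; refl; sym; trans; cong; subst)
open import Relation.Unary using (_∈_; _⊆_; _≐_)
open import Defs

private
  variable
    ℓ : Level
    Y : Set ℓ

i+j-j≡i : ∀ i j → (i + j) + - j ≡ i
i+j-j≡i i j =
  trans (+-assoc i j (- j)) (trans (cong (i +_) (+-inverseʳ j)) (+-identityʳ i))

i-j+j≡i : ∀ i j → (i + - j) + j ≡ i
i-j+j≡i i j =
  trans (+-assoc i (- j) j) (trans (cong (i +_) (+-inverseˡ j)) (+-identityʳ i))

-- Together with `⊆⊕-⇒⊕⊆`, this trades a shift of a formula for the opposite shift of the model,
-- under which a shift-closed family is stable.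
⊕⊆⇒⊆⊕- : ∀ {A M : Subset Y} i → A ⊕ i ⊆ M → A ⊆ M ⊕ (- i)
⊕⊆⇒⊆⊕- i A+i⊆M {y , k} a =
  y , k + i , A+i⊆M (y , k , a , refl) , cong (y ,_) (sym (i+j-j≡i k i))

⊆⊕-⇒⊕⊆ : ∀ {B M : Subset Y} i → B ⊆ M ⊕ (- i) → B ⊕ i ⊆ M
⊆⊕-⇒⊕⊆ {M = M} i B⊆M-i (y , k , b , refl) with B⊆M-i b
... | _ , j , m , refl = subst (λ l → M (y , l)) (sym (i-j+j≡i j i)) m

⊕0⊆ : (M : Subset Y) → M ⊕ 0ℤ ⊆ M
⊕0⊆ M (y , k , m , refl) = subst (λ l → M (y , l)) (sym (+-identityʳ k)) m

⊆⊕0 : (M : Subset Y) → M ⊆ M ⊕ 0ℤ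
⊆⊕0 M {y , k} m = y , k , m , cong (y ,_) (sym (+-identityʳ k))

singleton-finite : (t : 𝒯 Y) → Finite (_≡ t)
singleton-finite t = [ t ] , here , singleton⁻

-- Membership amounts to truth at shift 0 alone in every member of `𝒮`.
Th : Family Y → Theory Y
Th 𝒮 ((A , _) ⇒ (B , _)) = B ⊆ C 𝒮 A

⊆Mod-Th : {𝒮 : Family Y} → ShiftClosed 𝒮 → 𝒮 ⊆ Mod (Th 𝒮)
⊆Mod-Th shift {M} M∈𝒮 (_ ⇒ _) B⊆CA i A+i⊆M =
  ⊆⊕-⇒⊕⊆ i λ b →
    B⊆CA b (M ⊕ (- i)) (shift M (- i) M∈𝒮 , ⊕⊆⇒⊆⊕- i A+i⊆M)

Mod-Th-closed : {𝒮 : Family Y} → IsAlgebraic 𝒮 →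
  ∀ {M} → M ∈ Mod (Th 𝒮) → C 𝒮 M ⊆ M
Mod-Th-closed alg {M} M⊨Th {t} t∈CM with proj₁ (alg M) t∈CM
... | B , B⊆M , B-finite , t∈CB =
  -- `M` itself may be infinite; the finite `B` is admissible as an antecedent.
  M⊨Th ((B , B-finite) ⇒ ((_≡ t) , singleton-finite t))
    -- Shifting by `0ℤ` is the identity only up to extensional equality, hence the two conversions.
    (λ { refl → t∈CB }) 0ℤ (λ b → B⊆M (⊕0⊆ B b)) (⊆⊕0 (_≡ t) refl)

-- A model coincides with its closure, an intersection of members of `𝒮`. Extensivity of the closure
-- gives the other inclusion.
Mod-Th⊆ : {𝒮 : Family Y} → IsClosureSystem 𝒮 → IsAlgebraic 𝒮 → Mod (Th 𝒮) ⊆ 𝒮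
Mod-Th⊆ {𝒮 = 𝒮} closure alg {M} M⊨Th =
  closure (λ N → N ∈ 𝒮 × M ⊆ N) proj₁ M
    ((λ m N (_ , M⊆N) → M⊆N m) , Mod-Th-closed alg M⊨Th)

theorem3 : ∀ {ℓ} (Y : Set ℓ) (n : ℕ) → Y ↔ Fin n → Y →
    (𝒮 : Family Y) → IsClosureSystem 𝒮 → IsAlgebraic 𝒮 → ShiftClosed 𝒮 →
    ∃ λ (Σ : Theory Y) → 𝒮 ≐ Mod Σ
theorem3 Y n _ _ 𝒮 closure alg shift =
  Th 𝒮 , ⊆Mod-Th shift , Mod-Th⊆ closure alg
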